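{- Let $A$ be a DLE, let $\varepsilon$ be an order-type on $n\in\mathbb N$, let $\overline p=(p_1,\dots,p_n)$ and $\overline q=(q_1,\dots,q_n)$ be $n$-tuples of propositional variables, and let $\pi(\overline p)$ be an $n$-ary DLE-term which is positive as a map $A^\varepsilon\to A$. If $$A\models \pi(\overline p\vee\overline q)\le \pi(\overline p)\vee\pi(\overline q),$$ then $$A^\delta\models \pi(\overline p\vee\overline q)\le \pi(\overline p)\vee\pi(\overline q).$$
   Context: Fix disjoint sets $\mathcal F,\mathcal G$ of connectives; each $f\in\mathcal F$ (resp. $g\in\mathcal G$) has an arity $n_f$ (resp. $n_g$) and an order-type $\varepsilon_f\in\{1,\partial\}^{n_f}$ (resp. $\varepsilon_g\in\{1,\partial\}^{n_g}$). DLE-terms are built from propositional variables and $\bot,\top$ by $\wedge,\vee$ and the connectives in $\mathcal F\cup\mathcal G$. A DLE (normal distributive lattice expansion) is a bounded distributive lattice (BDL) $A$ with operations $f^A,g^A$ of the given arities such that, in each coordinate $i$: $f^A$ preserves finite (including empty) joins if $\varepsilon_f(i)=1$ and sends finite (including empty) meets to joins if $\varepsilon_f(i)=\partial$; $g^A$ preserves finite (including empty) meets if $\varepsilon_g(i)=1$ and sends finite (including empty) joins to meets if $\varepsilon_g(i)=\partial$. $A\models s\le t$ means that $s\le t$ holds in $A$ under every assignment of the variables to elements of $A$. An order-type on $n$ is an element $\varepsilon\in\{1,\partial\}^n$. $A^\varepsilon$ is the product lattice whose $i$-th factor is $A$ if $\varepsilon_i=1$ and the order-dual $A^\partial$ if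 $\varepsilon_i=\partial$. An occurrence of a variable in a term is positive if the number of argument places of order-type $\partial$ it lies under is even, and negative otherwise ($\wedge,\vee$ have order-type $1$ in both arguments). The term $\pi(\overline p)$ is positive as a map $A^\varepsilon\to A$ if every occurrence of $p_i$ is positive when $\varepsilon_i=1$ and negative when $\varepsilon_i=\partial$. The join $\overline p\vee\overline q$ is computed in $A^\varepsilon$ (resp. $(A^\delta)^\varepsilon$): its $i$-th coordinate is $p_i\vee q_i$ if $\varepsilon_i=1$ and $p_i\wedge q_i$ if $\varepsilon_i=\partial$. The canonical extension of a BDL $A$ is the (unique up to isomorphism) complete BDL $A^\delta$ containing $A$ as a sublattice such that (denseness) every element of $A^\delta$ is both a join of meets and a meet of joins of elements of $A$, and (compactness) for all $S,T\subseteq A$ with $\bigwedge S\le\bigvee T$ in $A^\delta$ there are finite $F\subseteq S$, $G\subseteq T$ with $\bigwedge F\le\bigvee G$. $K(A^\delta)$ (closed elements) is the set of meets, and $O(A^\delta)$ (open elements) the set of joins, of subsets of $A$. For an order-preserving map $h:A\to B$ of BDLs and $u\in A^\delta$, $h^\sigma(u)=\bigvee\{\bigwedge\{h(a): x\le a\in A\}: u\ge x\in K(A^\delta)\}$ and $h^\pi(u)=\bigwedge\{\bigvee\{h(a): y\ge a\in A\}: u\le y\in O(A^\delta)\}$. The canonical extension of a DLE $A$ is the lattice $A^\delta$ with operations $f^\sigma$ ($f\in\mathcal F$) and $g^\pi$ ($g\in\mathcal G$), where $f$ is regarded as an order-preserving map $A^{\varepsilon_f}\to A$ (similarly $g$)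 and $(A^{\varepsilon})^\delta$ is identified with $(A^\delta)^{\varepsilon}$. Terms are interpreted in $A^\delta$ using these operations. -}

module Defs where

open import Level using (Level; _⊔_) renaming (suc to lsuc)
open import Data.Nat.Base using (ℕ)
open import Data.Fin.Base using (Fin)
open import Data.Sign.Base as Sign using (Sign)
open import Data.Sum.Base using (_⊎_; inj₁; inj₂)
open import Data.Product.Base using (_×_; ∃; ∃-syntax; ∃₂)
open import Data.List.Base using (List; foldr)
open import Data.List.Relation.Unary.All using (All)
open import Data.Vec.Functional using (Vector; updateAt)
open import Function.Base using (_∘_; const)
open import Relation.Unary using (Pred; _∈_; _⊆_)
open import Relation.Binary.Bundles using (Poset)
open import Relation.Binary.Structures using (IsPartialOrder)
open import Relation.Binary.Lattice.Bundles using (BoundedLattice)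
open import Relation.Binary.PropositionalEquality.Core using (_≡_)
open import Algebra.Definitions using (_DistributesOverˡ_)
open import Algebra.Lattice.Bundles using (RawLattice)
open import Algebra.Lattice.Morphism.Structures using (module LatticeMorphisms)

private
  variable
    o ℓ p c v w : Level
    n : ℕ

------------------------------------------------------------------------
-- Order-types and signatures

-- The two symbols 1 and ∂ are the two signs, so that `Sign._*_` counts
-- occurrences of ∂ modulo 2.

pattern 𝟏 = Sign.+
pattern ∂ = Sign.-

OrderType : ℕ → Set
OrderType n = Vector Sign n

record Signature o : Set (lsuc o) where
  field
    F  : Set o
    G  : Set o
    nᶠ : F → ℕ
    nᵍ : G → ℕ
    εᶠ : (f : F) → OrderType (nᶠ f)
    εᵍ : (g : G) → OrderType (nᵍ g)

------------------------------------------------------------------------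
-- Terms

module _ (𝓢 : Signature o) where
  open Signature 𝓢

  data Term (V : Set v) : Set (o ⊔ v) where
    var         : V → Term V
    ⊥ᵗ ⊤ᵗ       : Term V
    _∧ᵗ_ _∨ᵗ_   : Term V → Term V → Term V
    opᶠ         : (f : F) → Vector (Term V) (nᶠ f) → Term V
    opᵍ         : (g : G) → Vector (Term V) (nᵍ g) → Term V

module _ {𝓢 : Signature o} where
  open Signature 𝓢

  infix 25 _[_]

  _[_] : {V : Set v} {W : Set w} → Term 𝓢 V → (V → Term 𝓢 W) → Term 𝓢 W
  var x    [ θ ] = θ x
  ⊥ᵗ       [ θ ] = ⊥ᵗ
  ⊤ᵗ       [ θ ] = ⊤ᵗ
  (s ∧ᵗ t) [ θ ] = (s [ θ ]) ∧ᵗ (t [ θ ])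
  (s ∨ᵗ t) [ θ ] = (s [ θ ]) ∨ᵗ (t [ θ ])
  opᶠ f ts [ θ ] = opᶠ f (λ i → ts i [ θ ])
  opᵍ g ts [ θ ] = opᵍ g (λ i → ts i [ θ ])

  -- `Occurs x s t`: the variable x has an occurrence in t lying under an
  -- even (s = 𝟏) or odd (s = ∂) number of argument places of order-type ∂.

  data Occurs {V : Set v} (x : V) : Sign → Term 𝓢 V → Set (o ⊔ v) where
    here  : Occurs x 𝟏 (var x)
    in-∧ˡ : ∀ {s t u} → Occurs x s t → Occurs x s (t ∧ᵗ u)
    in-∧ʳ : ∀ {s t u} → Occurs x s u → Occurs x s (t ∧ᵗ u)
    in-∨ˡ : ∀ {s t u} → Occurs x s t → Occurs x s (t ∨ᵗ u)
    in-∨ʳ : ∀ {s t u} → Occurs x s u → Occurs x s (t ∨ᵗ u)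
    in-f  : ∀ {s f ts} i → Occurs x s (ts i) →
            Occurs x (εᶠ f i Sign.* s) (opᶠ f ts)
    in-g  : ∀ {s g ts} i → Occurs x s (ts i) →
            Occurs x (εᵍ g i Sign.* s) (opᵍ g ts)

  -- Positivity of an n-ary term as a map A^ε → A.

  PositiveAs : OrderType n → Term 𝓢 (Fin n) → Set o
  PositiveAs ε t = ∀ i s → Occurs i s t → s ≡ ε i

  -- The coordinatewise join of two tuples of terms, computed in the
  -- ε-power: ∂-coordinates carry the reversed order, whose join is ∧.

  joinᵗ : {V : Set v} → Sign → Term 𝓢 V → Term 𝓢 V → Term 𝓢 V
  joinᵗ 𝟏 s t = s ∨ᵗ t
  joinᵗ ∂ s t = s ∧ᵗ t

  _∨[_]_ : {V : Set v} →
           Vector (Term 𝓢 V) n → OrderType n → Vector (Term 𝓢 V) n →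
           Vector (Term 𝓢 V) n
  (s ∨[ ε ] t) i = joinᵗ (ε i) (s i) (t i)

  -- Two disjoint n-tuples of distinct propositional variables.

  p̄ q̄ : Vector (Term 𝓢 (Fin n ⊎ Fin n)) n
  p̄ i = var (inj₁ i)
  q̄ i = var (inj₂ i)

------------------------------------------------------------------------
-- Bounded distributive lattices and their expansions

record BDL ℓ : Set (lsuc ℓ) where
  field
    boundedLattice : BoundedLattice ℓ ℓ ℓ

  open BoundedLattice boundedLattice public

  field
    ∧-distribˡ-∨ : _DistributesOverˡ_ _≈_ _∧_ _∨_

  rawLattice : RawLattice ℓ ℓ
  rawLattice = record { _≈_ = _≈_ ; _∧_ = _∧_ ; _∨_ = _∨_ }

  -- Binary and empty joins and meets of the lattice (𝟏) or its dual (∂).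

  join meet : Sign → Carrier → Carrier → Carrier
  join 𝟏 = _∨_
  join ∂ = _∧_
  meet 𝟏 = _∧_
  meet ∂ = _∨_

  bottom top : Sign → Carrier
  bottom 𝟏 = ⊥
  bottom ∂ = ⊤
  top 𝟏 = ⊤
  top ∂ = ⊥

-- A bounded distributive lattice with arbitrary operations interpreting
-- the connectives; what is needed to interpret terms.

record Expansion (𝓢 : Signature o) ℓ : Set (o ⊔ lsuc ℓ) where
  open Signature 𝓢
  field
    bdl : BDL ℓ

  open BDL bdl public

  field
    ⟦_⟧ᶠ : (f : F) → Vector Carrier (nᶠ f) → Carrier
    ⟦_⟧ᵍ : (g : G) → Vector Carrier (nᵍ g) → Carrier

  ⟦_⟧ : {V : Set v} → Term 𝓢 V → (V → Carrier) → Carrier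
  ⟦ var x    ⟧ ρ = ρ x
  ⟦ ⊥ᵗ       ⟧ ρ = ⊥
  ⟦ ⊤ᵗ       ⟧ ρ = ⊤
  ⟦ s ∧ᵗ t   ⟧ ρ = ⟦ s ⟧ ρ ∧ ⟦ t ⟧ ρ
  ⟦ s ∨ᵗ t   ⟧ ρ = ⟦ s ⟧ ρ ∨ ⟦ t ⟧ ρ
  ⟦ opᶠ f ts ⟧ ρ = ⟦ f ⟧ᶠ (λ i → ⟦ ts i ⟧ ρ)
  ⟦ opᵍ g ts ⟧ ρ = ⟦ g ⟧ᵍ (λ i → ⟦ ts i ⟧ ρ)

infix 4 _⊨_≤_

_⊨_≤_ : {𝓢 : Signature o} {V : Set v} →
        Expansion 𝓢 ℓ → Term 𝓢 V → Term 𝓢 V → Set (v ⊔ ℓ)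
A ⊨ s ≤ t = ∀ ρ → ⟦ s ⟧ ρ ≤ ⟦ t ⟧ ρ
  where open Expansion A

record IsNormal {𝓢 : Signature o} (A : Expansion 𝓢 ℓ) : Set (o ⊔ ℓ) where
  open Signature 𝓢
  open Expansion A
  field
    f-cong : ∀ f {xs ys} → (∀ i → xs i ≈ ys i) → ⟦ f ⟧ᶠ xs ≈ ⟦ f ⟧ᶠ ys
    g-cong : ∀ g {xs ys} → (∀ i → xs i ≈ ys i) → ⟦ g ⟧ᵍ xs ≈ ⟦ g ⟧ᵍ ys

    f-join : ∀ f i xs a b →
      ⟦ f ⟧ᶠ (updateAt xs i (const (join (εᶠ f i) a b))) ≈
      ⟦ f ⟧ᶠ (updateAt xs i (const a)) ∨ ⟦ f ⟧ᶠ (updateAt xs i (const b))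
    f-bottom : ∀ f i xs →
      ⟦ f ⟧ᶠ (updateAt xs i (const (bottom (εᶠ f i)))) ≈ ⊥

    g-meet : ∀ g i xs a b →
      ⟦ g ⟧ᵍ (updateAt xs i (const (meet (εᵍ g i) a b))) ≈
      ⟦ g ⟧ᵍ (updateAt xs i (const a)) ∧ ⟦ g ⟧ᵍ (updateAt xs i (const b))
    g-top : ∀ g i xs →
      ⟦ g ⟧ᵍ (updateAt xs i (const (top (εᵍ g i)))) ≈ ⊤

record DLE (𝓢 : Signature o) ℓ : Set (o ⊔ lsuc ℓ) where
  field
    expansion : Expansion 𝓢 ℓ
    isNormal  : IsNormal expansion

  open Expansion expansion public
  open IsNormal isNormal public

------------------------------------------------------------------------
-- Powers by order-types

module _ (P : Poset ℓ ℓ ℓ) where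
  open Poset P

  leq : Sign → Carrier → Carrier → Set ℓ
  leq 𝟏 x y = x ≤ y
  leq ∂ x y = y ≤ x

  leq-isPartialOrder : ∀ s → IsPartialOrder _≈_ (leq s)
  leq-isPartialOrder 𝟏 = isPartialOrder
  leq-isPartialOrder ∂ = record
    { isPreorder = record
      { isEquivalence = isEquivalence
      ; reflexive     = λ x≈y → reflexive (Eq.sym x≈y)
      ; trans         = λ y≤x z≤y → trans z≤y y≤x
      }
    ; antisym = λ y≤x x≤y → antisym x≤y y≤x
    }

  -- The underlying poset of the product lattice P^ε. Only its order
  -- enters the definition of closed and open elements and of σ and π.

  infix 8 _^_

  _^_ : OrderType n → Poset ℓ ℓ ℓ
  _^_ {n} ε = record
    { Carrier        = Vector Carrier n
    ; _≈_            = λ xs ys → ∀ i → xs i ≈ ys i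
    ; _≤_            = λ xs ys → ∀ i → leq (ε i) (xs i) (ys i)
    ; isPartialOrder = record
      { isPreorder = record
        { isEquivalence = record
          { refl  = λ i → Eq.refl
          ; sym   = λ eq i → Eq.sym (eq i)
          ; trans = λ eq₁ eq₂ i → Eq.trans (eq₁ i) (eq₂ i)
          }
        ; reflexive = λ eq i → PO.reflexive (ε i) (eq i)
        ; trans     = λ le₁ le₂ i → PO.trans (ε i) (le₁ i) (le₂ i)
        }
      ; antisym = λ le₁ le₂ i → PO.antisym (ε i) (le₁ i) (le₂ i)
      }
    }
    where module PO s = IsPartialOrder (leq-isPartialOrder s)

------------------------------------------------------------------------
-- Suprema, infima and completeness

module _ (P : Poset ℓ ℓ ℓ) where
  open Poset P

  IsSupremum : Pred Carrier p → Carrier → Set (ℓ ⊔ p)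
  IsSupremum S u =
    (∀ x → x ∈ S → x ≤ u) × (∀ v → (∀ x → x ∈ S → x ≤ v) → u ≤ v)

  IsInfimum : Pred Carrier p → Carrier → Set (ℓ ⊔ p)
  IsInfimum S u =
    (∀ x → x ∈ S → u ≤ x) × (∀ v → (∀ x → x ∈ S → v ≤ x) → v ≤ u)

-- Subsets of a lattice A with carrier in `Set ℓ` are predicates of level
-- ℓ. The set of meets of subsets of A is then a predicate of level
-- `lsuc ℓ`, so this is the level at which subsets of a complete lattice
-- are taken.

record CompleteBDL ℓ : Set (lsuc (lsuc ℓ)) where
  field
    bdl : BDL ℓ

  open BDL bdl public

  field
    ⋁ ⋀       : Pred Carrier (lsuc ℓ) → Carrier
    ⋁-supremum : ∀ S → IsSupremum poset S (⋁ S)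
    ⋀-infimum  : ∀ S → IsInfimum poset S (⋀ S)

-- The set { h i | i ∈ S }.

data Image {I : Set ℓ} {X : Set c} (h : I → X) (S : Pred I p)
         : Pred X (lsuc ℓ ⊔ p) where
  image : ∀ {i} → i ∈ S → Image h S (h i)

-- Meets and joins, in P′, of subsets of P, where P sits in P′ via e.

module _ (P P′ : Poset ℓ ℓ ℓ) (e : Poset.Carrier P → Poset.Carrier P′) where

  Closed Open : Pred (Poset.Carrier P′) (lsuc ℓ)
  Closed x = ∃ λ (S : Pred (Poset.Carrier P) ℓ) → IsInfimum  P′ (Image e S) x
  Open   y = ∃ λ (S : Pred (Poset.Carrier P) ℓ) → IsSupremum P′ (Image e S) y

------------------------------------------------------------------------
-- Canonical extensions

record CanonicalExtension (A : BDL ℓ) : Set (lsuc (lsuc ℓ)) where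
  private module A = BDL A
  field
    completeBDL : CompleteBDL ℓ

  open CompleteBDL completeBDL public

  field
    e : A.Carrier → Carrier
    e-isLatticeMonomorphism :
      LatticeMorphisms.IsLatticeMonomorphism A.rawLattice rawLattice e
    e-⊤ : e A.⊤ ≈ ⊤
    e-⊥ : e A.⊥ ≈ ⊥

    dense-⋁⋀ : ∀ u → ∃[ X ] X ⊆ Closed A.poset poset e × u ≈ ⋁ X
    dense-⋀⋁ : ∀ u → ∃[ X ] X ⊆ Open A.poset poset e × u ≈ ⋀ X

    compact : (S T : Pred A.Carrier ℓ) →
      ⋀ (Image e S) ≤ ⋁ (Image e T) →
      ∃₂ λ (K L : List A.Carrier) → All S K × All T L ×
        foldr A._∧_ A.⊤ K A.≤ foldr A._∨_ A.⊥ L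

-- The extensions h^σ and h^π of h : P → B, where P sits in P′ (the
-- canonical extension of P) via i.

module _ (P P′ : Poset ℓ ℓ ℓ) (i : Poset.Carrier P → Poset.Carrier P′)
         {B : BDL ℓ} (Bδ : CanonicalExtension B)
         (h : Poset.Carrier P → BDL.Carrier B) where
  private
    module P′ = Poset P′
  open CanonicalExtension Bδ

  σ-ext : P′.Carrier → Carrier
  σ-ext u =
    ⋁ (Image (λ x → ⋀ (Image (λ a → e (h a)) (λ a → x P′.≤ i a)))
             (λ x → x ∈ Closed P P′ i × x P′.≤ u))

  π-ext : P′.Carrier → Carrier
  π-ext u =
    ⋀ (Image (λ y → ⋁ (Image (λ a → e (h a)) (λ a → i a P′.≤ y)))
             (λ y → y ∈ Open P P′ i × u P′.≤ y))

-- The canonical extension of a DLE; (A^ε)^δ is (A^δ)^ε, with A^ε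
-- embedded coordinatewise.

canonicalExtension : {𝓢 : Signature o} (A : DLE 𝓢 ℓ) →
                     CanonicalExtension (DLE.bdl A) → Expansion 𝓢 ℓ
canonicalExtension {𝓢 = 𝓢} A Aδ = record
  { bdl  = Aδ.bdl
  ; ⟦_⟧ᶠ = λ f → σ-ext (A.poset ^ εᶠ f) (Aδ.poset ^ εᶠ f) (Aδ.e ∘_)
                       Aδ A.⟦ f ⟧ᶠ
  ; ⟦_⟧ᵍ = λ g → π-ext (A.poset ^ εᵍ g) (Aδ.poset ^ εᵍ g) (Aδ.e ∘_)
                       Aδ A.⟦ g ⟧ᵍ
  }
  where
  open Signature 𝓢
  module A  = DLE A
  module Aδ = CanonicalExtension Aδ

{-# OPTIONS --safe #-}

-- On closed tuples k, π(k) is the meet of the π(a) with k ≤ a, and on open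
-- tuples y it is the join of the π(a) with a ≤ y. Let m ≥ π(u) ∨ π(v) be open.
-- Additivity on A makes { a ∣ π(a) ≤ m } an ideal; let ■ be its join, an open
-- tuple, so that π(■) ≤ m. If k ≤ u is closed, then π(k) ≤ m, and compactness
-- gives a ≥ k with π(a) ≤ m; hence u ≤ ■, and likewise v ≤ ■. Therefore
-- π(u ∨ v) ≤ π(■) ≤ m, and π(u) ∨ π(v) is the meet of such m. Only the
-- monotonicity of the connectives matters.

module Submission where

open import Defs
open import Level using (Level; _⊔_) renaming (suc to lsuc)
open import Data.Nat.Base using (ℕ; zero; suc)
open import Data.Fin.Base using (Fin; zero; suc)
open import Data.Fin.Properties using (_≟_)
open import Data.Sign.Base as Sign using (Sign; opposite)
open import Data.Sign.Properties using (opposite-involutive)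
open import Data.Sum.Base using (_⊎_; inj₁; inj₂; [_,_])
open import Data.Product.Base using (_×_; _,_; proj₁; proj₂; ∃; ∃-syntax; Σ)
open import Data.Unit.Polymorphic.Base using (tt) renaming (⊤ to Unit)
open import Data.List.Base using (foldr)
open import Data.List.Relation.Unary.All using (All; []; _∷_)
open import Data.Vec.Functional using (Vector; updateAt; head; tail) renaming (_∷_ to _◂_)
open import Function.Base using (_∘_; const; flip)
open import Relation.Nullary using (yes; no; contradiction)
open import Relation.Binary.Bundles using (Poset)
open import Relation.Binary.Structures using (IsPartialOrder)
import Relation.Binary.Construct.Flip.EqAndOrd as Flip
open import Relation.Binary.PropositionalEquality.Core
  using (_≡_; refl; sym; subst)
import Relation.Binary.Lattice.Properties.JoinSemilattice as JoinProperties
import Relation.Binary.Lattice.Properties.MeetSemilattice as MeetProperties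
import Relation.Binary.Lattice.Properties.Lattice as LatticeProperties
import Relation.Binary.Lattice.Properties.DistributiveLattice as DistributiveProperties
open import Algebra.Lattice.Morphism.Structures using (module LatticeMorphisms)

private
  variable
    o ℓ v w : Level
    n : ℕ

-- Orders and suprema by sign

*-transpose : ∀ a b {c} → a Sign.* b ≡ c → b ≡ a Sign.* c
*-transpose 𝟏 b eq   = eq
*-transpose ∂ b refl = sym (opposite-involutive b)

-- Every sign is its own inverse. This carries the sign of an occurrence in a compound term back to
-- its sign in the argument where it lies.
*-transpose² : ∀ a b s c → a Sign.* b ≡ s Sign.* c → b ≡ (s Sign.* a) Sign.* c
*-transpose² a b 𝟏 c eq = *-transpose a b eq
*-transpose² 𝟏 b ∂ c eq = eq
*-transpose² ∂ b ∂ c eq with refl ← *-transpose ∂ b eq = opposite-involutive c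

opposite-* : ∀ s t → opposite s Sign.* t ≡ opposite (s Sign.* t)
opposite-* 𝟏 t = refl
opposite-* ∂ t = sym (opposite-involutive t)

-- Defined by a test on the index rather than by recursion like `updateAt`, so that claims about a
-- coordinate split into the replaced one and the untouched ones.
_[_]≔_ : {X : Set v} → Vector X n → Fin n → X → Vector X n
(xs [ i ]≔ x) j with j ≟ i
... | yes _ = x
... | no _  = xs j

module Signed (P : Poset ℓ ℓ ℓ) where
  open Poset P

  leq-refl : ∀ s {x} → leq P s x x
  leq-refl s = IsPartialOrder.refl (leq-isPartialOrder P s)

  leq-trans : ∀ s {x y z} → leq P s x y → leq P s y z → leq P s x z
  leq-trans s = IsPartialOrder.trans (leq-isPartialOrder P s)

  leq-opposite⁺ : ∀ s {x y} → leq P s x y → leq P (opposite s) y x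
  leq-opposite⁺ 𝟏 x≤y = x≤y
  leq-opposite⁺ ∂ x≤y = x≤y

  leq-opposite⁻ : ∀ s {x y} → leq P (opposite s) x y → leq P s y x
  leq-opposite⁻ 𝟏 x≤y = x≤y
  leq-opposite⁻ ∂ x≤y = x≤y

  -- The supremum of the family for `𝟏` and its infimum for `∂`. Families replace subsets so that
  -- one index type can follow a whole term.
  IsLimit : Sign → {J : Set ℓ} → (J → Carrier) → Carrier → Set ℓ
  IsLimit s φ y = (∀ j → leq P s (φ j) y) ×
                  (∀ w → (∀ j → leq P s (φ j) w) → leq P s y w)

open Signed

module _ (P : Poset ℓ ℓ ℓ) {n} (ε : OrderType n) where
  open Poset P using (Carrier)

  pow-leq⁺ : ∀ s {x y} → (∀ i → leq P (s Sign.* ε i) (x i) (y i)) → leq (P ^ ε) s x y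
  pow-leq⁺ 𝟏 x≤y i = x≤y i
  pow-leq⁺ ∂ x≤y i = leq-opposite⁻ P (ε i) (x≤y i)

  pow-leq⁻ : ∀ s {x y} → leq (P ^ ε) s x y → ∀ i → leq P (s Sign.* ε i) (x i) (y i)
  pow-leq⁻ 𝟏 x≤y i = x≤y i
  pow-leq⁻ ∂ x≤y i = leq-opposite⁺ P (ε i) (x≤y i)

  pow-limit⁺ : ∀ s {J : Set ℓ} {φ : J → Vector Carrier n} {y} →
    (∀ i → IsLimit P (s Sign.* ε i) (λ j → φ j i) (y i)) → IsLimit (P ^ ε) s φ y
  pow-limit⁺ s lim =
    (λ j → pow-leq⁺ s (λ i → proj₁ (lim i) j)) ,
    (λ w φ≤w → pow-leq⁺ s (λ i → proj₂ (lim i) (w i) (λ j → pow-leq⁻ s (φ≤w j) i)))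

  -- To test a bound w in coordinate i, put w there and keep y elsewhere: this tuple bounds the
  -- whole family, hence also y.
  pow-limit⁻ : ∀ s {J : Set ℓ} {φ : J → Vector Carrier n} {y} →
    IsLimit (P ^ ε) s φ y → ∀ i → IsLimit P (s Sign.* ε i) (λ j → φ j i) (y i)
  pow-limit⁻ s {φ = φ} {y} (ub , least) i = (λ j → pow-leq⁻ s (ub j) i) , least′
    where
    least′ : ∀ w → (∀ j → leq P (s Sign.* ε i) (φ j i) w) → leq P (s Sign.* ε i) (y i) w
    least′ w φ≤w = at-i (pow-leq⁻ s (least (y [ i ]≔ w) (λ j → pow-leq⁺ s (below j))) i)
      where
      below : ∀ j k → leq P (s Sign.* ε k) (φ j k) ((y [ i ]≔ w) k)
      below j k with k ≟ i
      ... | yes refl = φ≤w j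
      ... | no _     = pow-leq⁻ s (ub j) k

      at-i : leq P (s Sign.* ε i) (y i) ((y [ i ]≔ w) i) → leq P (s Sign.* ε i) (y i) w
      at-i le with i ≟ i
      ... | yes _  = le
      ... | no i≢i = contradiction refl i≢i

-- Directed families and approximation

record DirectedSet ℓ : Set (lsuc ℓ) where
  infix 4 _⊑_
  field
    Index   : Set ℓ
    _⊑_     : Index → Index → Set ℓ
    ⊑-trans : ∀ {i j k} → i ⊑ j → j ⊑ k → i ⊑ k
    point   : Index
    bound   : ∀ i j → ∃[ k ] i ⊑ k × j ⊑ k

  bound-all : (c : Fin n → Index) → ∃[ k ] (∀ i → c i ⊑ k)
  bound-all {zero}  c = point , λ ()
  bound-all {suc n} c =
    let k , c≤k   = bound-all (c ∘ suc)
        m , c₀≤m , k≤m = bound (c zero) k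
    in m , λ { zero → c₀≤m ; (suc i) → ⊑-trans (c≤k i) k≤m }

-- For s = 𝟏 these are the closed elements, for s = ∂ the open ones.

module _ (P P′ : Poset ℓ ℓ ℓ) (e : Poset.Carrier P → Poset.Carrier P′) where

  IsClosed : Sign → Poset.Carrier P′ → Set (lsuc ℓ)
  IsClosed s x = Σ (Set ℓ) λ K → Σ (K → Poset.Carrier P) λ κ →
                 IsLimit P′ (opposite s) (e ∘ κ) x

  Closed⇒IsClosed : ∀ {x} → Closed P P′ e x → IsClosed 𝟏 x
  Closed⇒IsClosed (S , lower , greatest) = ∃ S , proj₁ ,
    (λ { (a , a∈S) → lower (e a) (image a∈S) }) ,
    (λ w w≤ → greatest w (λ { _ (image a∈S) → w≤ (_ , a∈S) }))

  Open⇒IsClosed : ∀ {y} → Open P P′ e y → IsClosed ∂ y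
  Open⇒IsClosed (S , upper , least) = ∃ S , proj₁ ,
    (λ { (a , a∈S) → upper (e a) (image a∈S) }) ,
    (λ w ≤w → least w (λ { _ (image a∈S) → ≤w (_ , a∈S) }))

  embedded-IsClosed : ∀ s a → IsClosed s (e a)
  embedded-IsClosed s a = Unit , const a ,
    (λ _ → leq-refl P′ (opposite s)) , (λ w e≤w → e≤w tt)

  -- This isolates what the extension of a map needs to know about powers of A: besides being a
  -- limit of β, y satisfies compactness with respect to β. For `𝟏`, a closed element below y is
  -- below some member; for `∂`, an open element above y is above some member.
  record Approximates (s : Sign) {J : Set ℓ} (β : J → Poset.Carrier P)
                      (y : Poset.Carrier P′) : Set (lsuc ℓ) where
    constructor approx
    field
      limit : IsLimit P′ s (e ∘ β) y
      catch : ∀ {x} → IsClosed s x → leq P′ s x y → ∃[ j ] leq P′ s x (e (β j))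

-- Duality

dual : BDL ℓ → BDL ℓ
dual A = record
  { boundedLattice = record
    { _≈_ = _≈_ ; _≤_ = flip _≤_ ; _∨_ = _∧_ ; _∧_ = _∨_ ; ⊤ = ⊥ ; ⊥ = ⊤
    ; isBoundedLattice = record
      { isLattice = LatticeProperties.∧-∨-isLattice lattice
      ; maximum   = minimum
      ; minimum   = maximum
      }
    }
  ; ∧-distribˡ-∨ = DistributiveProperties.∨-distribˡ-∧ (record
      { isDistributiveLattice = record
        { isLattice = isLattice ; ∧-distribˡ-∨ = ∧-distribˡ-∨ } })
  }
  where open BDL A

-- The axioms are self-dual: the two halves of denseness trade places, and so do the two sets in
-- compactness. Facts for the sign `∂` are thus facts for `𝟏` in the dual.
dualᶜ : {A : BDL ℓ} → CanonicalExtension A → CanonicalExtension (dual A)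
dualᶜ Aδ = record
  { completeBDL = record
    { bdl = dual bdl
    ; ⋁ = ⋀ ; ⋀ = ⋁ ; ⋁-supremum = ⋀-infimum ; ⋀-infimum = ⋁-supremum
    }
  ; e = e
  ; e-isLatticeMonomorphism = record
    { isLatticeHomomorphism = record
      { isRelHomomorphism = isRelHomomorphism ; ∧-homo = ∨-homo ; ∨-homo = ∧-homo }
    ; injective = injective
    }
  ; e-⊤ = e-⊥
  ; e-⊥ = e-⊤
  ; dense-⋁⋀ = dense-⋀⋁
  ; dense-⋀⋁ = dense-⋁⋀
  ; compact  = λ S T p → let K , L , K⊆ , L⊆ , le = compact T S p in L , K , L⊆ , K⊆ , le
  }
  where
  open CanonicalExtension Aδ
  open LatticeMorphisms.IsLatticeMonomorphism e-isLatticeMonomorphism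

-- Canonical extensions

module Unsigned {A : BDL ℓ} (Aδ : CanonicalExtension A) where
  private module A = BDL A
  open CanonicalExtension Aδ hiding (refl; supremum)
  open LatticeMorphisms.IsLatticeMonomorphism e-isLatticeMonomorphism
    using (∧-homo; ∨-homo; ⟦⟧-cong; injective)
  private
    module A∨ = JoinProperties A.joinSemilattice

  e-mono : ∀ {a b} → a A.≤ b → e a ≤ e b
  e-mono {a} {b} a≤b = trans (x≤x∨y (e a) (e b))
    (reflexive (Eq.trans (Eq.sym (∨-homo a b)) (⟦⟧-cong (A∨.x≤y⇒x∨y≈y a≤b))))

  e-reflects : ∀ {a b} → e a ≤ e b → a A.≤ b
  e-reflects {a} {b} ea≤eb = A.trans (A.x≤x∨y a b)
    (A.reflexive (injective (Eq.trans (∨-homo a b)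
      (JoinProperties.x≤y⇒x∨y≈y joinSemilattice ea≤eb))))

  -- By denseness u is a join of closed elements, so these suffice as tests.
  ≤-via-closed : ∀ {u w} →
    (∀ {x} → IsClosed A.poset poset e 𝟏 x → x ≤ u → x ≤ w) → u ≤ w
  ≤-via-closed {u} {w} below with X , X⊆ , u≈ ← dense-⋁⋀ u =
    trans (reflexive u≈) (proj₂ (⋁-supremum X) w (λ x x∈X →
      below (Closed⇒IsClosed A.poset poset e (X⊆ x∈X))
            (trans (proj₁ (⋁-supremum X) x x∈X) (reflexive (Eq.sym u≈)))))

  supremum : {J : Set ℓ} (φ : J → A.Carrier) → ∃[ y ] IsLimit poset 𝟏 (e ∘ φ) y
  supremum φ = ⋁ (Image e S) ,
    (λ j → proj₁ (⋁-supremum _) _ (image (j , refl))) ,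
    (λ w φ≤w → proj₂ (⋁-supremum _) w (λ { _ (image (j , refl)) → φ≤w j }))
    where
    S = λ a → ∃[ j ] φ j ≡ a

  limit-⊥ : ∀ {J : Set ℓ} → IsLimit poset 𝟏 {J} (const (e A.⊥)) ⊥
  limit-⊥ = (λ _ → reflexive e-⊥) , (λ w _ → minimum w)

  limit-⊤ : ∀ {J : Set ℓ} → J → IsLimit poset 𝟏 {J} (const (e A.⊤)) ⊤
  limit-⊤ j = (λ _ → reflexive e-⊤) , (λ w e≤w → trans (reflexive (Eq.sym e-⊤)) (e≤w j))

  module _ (D : DirectedSet ℓ) where
    open DirectedSet D

    -- The axiom yields a finite meet of values of κ below a finite join of values of φ. The meet is
    -- above x, and directedness puts the join below a single value of φ.
    compactness : ∀ {φ : Index → A.Carrier} {x y} →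
      (∀ {j k} → j ⊑ k → φ j A.≤ φ k) →
      IsLimit poset 𝟏 (e ∘ φ) y → IsClosed A.poset poset e 𝟏 x → x ≤ y →
      ∃[ j ] x ≤ e (φ j)
    compactness {φ} {x} {y} φ-mono (_ , least) (K , κ , lower , greatest) x≤y =
      let Ks , Ls , Ks⊆ , Ls⊆ , Ks≤Ls = compact S T ⋀S≤⋁T
          j , Ls≤φ = join-below Ls⊆
      in j , trans (above-meet Ks⊆) (e-mono (A.trans Ks≤Ls Ls≤φ))
      where
      S T : A.Carrier → Set ℓ
      S a = ∃[ k ] κ k ≡ a
      T a = ∃[ j ] φ j ≡ a

      ⋀S≤⋁T : ⋀ (Image e S) ≤ ⋁ (Image e T)
      ⋀S≤⋁T = trans
        (greatest _ (λ k → proj₁ (⋀-infimum _) _ (image (k , refl))))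
        (trans x≤y (least _ (λ j → proj₁ (⋁-supremum _) _ (image (j , refl)))))

      join-below : ∀ {L} → All T L → ∃[ j ] foldr A._∨_ A.⊥ L A.≤ φ j
      -- The empty join is bottom, so any index will do.
      join-below [] = point , A.minimum _
      join-below ((i , refl) ∷ L⊆) =
        let j , L≤φ = join-below L⊆
            k , i⊑k , j⊑k = bound i j
        in k , A.∨-least (φ-mono i⊑k) (A.trans L≤φ (φ-mono j⊑k))

      above-meet : ∀ {L} → All S L → x ≤ e (foldr A._∧_ A.⊤ L)
      above-meet [] = trans (maximum x) (reflexive (Eq.sym e-⊤))
      above-meet ((k , refl) ∷ L⊆) =
        trans (∧-greatest (lower k) (above-meet L⊆)) (reflexive (Eq.sym (∧-homo _ _)))

    module _ {φ ψ : Index → A.Carrier} {x y}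
             (φ-mono : ∀ {j k} → j ⊑ k → φ j A.≤ φ k)
             (ψ-mono : ∀ {j k} → j ⊑ k → ψ j A.≤ ψ k)
             (φ-lim : IsLimit poset 𝟏 (e ∘ φ) x)
             (ψ-lim : IsLimit poset 𝟏 (e ∘ ψ) y) where

      -- Instead of infinite distributivity, closed test elements are used: one below x ∧ y is
      -- caught by some φ i and some ψ j, hence by both families at a common later index.
      limit-∧ : IsLimit poset 𝟏 (λ j → e (φ j A.∧ ψ j)) (x ∧ y)
      limit-∧ =
        (λ j → ∧-greatest (trans (e-mono (A.x∧y≤x _ _)) (proj₁ φ-lim j))
                          (trans (e-mono (A.x∧y≤y _ _)) (proj₁ ψ-lim j))) ,
        (λ w ≤w → ≤-via-closed (λ cl z≤x∧y →
          let i , z≤φ = compactness φ-mono φ-lim cl (trans z≤x∧y (x∧y≤x x y))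
              j , z≤ψ = compactness ψ-mono ψ-lim cl (trans z≤x∧y (x∧y≤y x y))
              k , i⊑k , j⊑k = bound i j
          in trans (∧-greatest (trans z≤φ (e-mono (φ-mono i⊑k)))
                               (trans z≤ψ (e-mono (ψ-mono j⊑k))))
                   (trans (reflexive (Eq.sym (∧-homo _ _))) (≤w k))))

      limit-∨ : IsLimit poset 𝟏 (λ j → e (φ j A.∨ ψ j)) (x ∨ y)
      limit-∨ =
        (λ j → trans (reflexive (∨-homo _ _))
                     (∨-least (trans (proj₁ φ-lim j) (x≤x∨y x y))
                              (trans (proj₁ ψ-lim j) (y≤x∨y x y)))) ,
        (λ w ≤w → ∨-least
          (proj₂ φ-lim w (λ j → trans (e-mono (A.x≤x∨y _ _)) (≤w j)))
          (proj₂ ψ-lim w (λ j → trans (e-mono (A.y≤x∨y _ _)) (≤w j))))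

-- The same facts for both signs, and for powers

module Canonical {A : BDL ℓ} (Aδ : CanonicalExtension A) where
  private
    module A = BDL A
    module Aδ = CanonicalExtension Aδ
    module U = Unsigned Aδ
    module U∂ = Unsigned (dualᶜ Aδ)
  open Aδ using (e)
  open LatticeMorphisms.IsLatticeMonomorphism Aδ.e-isLatticeMonomorphism
    using (∧-homo; ∨-homo)

  e-mono : ∀ s {a b} → leq A.poset s a b → leq Aδ.poset s (e a) (e b)
  e-mono 𝟏 = U.e-mono
  e-mono ∂ = U.e-mono

  e-reflects : ∀ s {a b} → leq Aδ.poset s (e a) (e b) → leq A.poset s a b
  e-reflects 𝟏 = U.e-reflects
  e-reflects ∂ = U.e-reflects

  leq-via-closed : ∀ s {u w} →
    (∀ {x} → IsClosed A.poset Aδ.poset e s x → leq Aδ.poset s x u → leq Aδ.poset s x w) →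
    leq Aδ.poset s u w
  leq-via-closed 𝟏 = U.≤-via-closed
  leq-via-closed ∂ = U∂.≤-via-closed

  supremum : ∀ s {J : Set ℓ} (φ : J → A.Carrier) → ∃[ y ] IsLimit Aδ.poset s (e ∘ φ) y
  supremum 𝟏 = U.supremum
  supremum ∂ = U∂.supremum

  limit-⊥ : ∀ s {J : Set ℓ} → J → IsLimit Aδ.poset s {J} (const (e A.⊥)) Aδ.⊥
  limit-⊥ 𝟏 _ = U.limit-⊥
  limit-⊥ ∂ j = U∂.limit-⊤ j

  limit-⊤ : ∀ s {J : Set ℓ} → J → IsLimit Aδ.poset s {J} (const (e A.⊤)) Aδ.⊤
  limit-⊤ 𝟏 j = U.limit-⊤ j
  limit-⊤ ∂ _ = U∂.limit-⊥

  e-bottom : ∀ s {u} → leq Aδ.poset s (e (A.bottom s)) u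
  e-bottom 𝟏 = Aδ.trans (Aδ.reflexive Aδ.e-⊥) (Aδ.minimum _)
  e-bottom ∂ = Aδ.trans (Aδ.maximum _) (Aδ.reflexive (Aδ.Eq.sym Aδ.e-⊤))

  e-top : ∀ s {u} → leq Aδ.poset s u (e (A.top s))
  e-top 𝟏 = Aδ.trans (Aδ.maximum _) (Aδ.reflexive (Aδ.Eq.sym Aδ.e-⊤))
  e-top ∂ = Aδ.trans (Aδ.reflexive Aδ.e-⊥) (Aδ.minimum _)

  e-meet : ∀ s {u a b} → leq Aδ.poset s u (e a) → leq Aδ.poset s u (e b) →
           leq Aδ.poset s u (e (A.meet s a b))
  e-meet 𝟏 u≤a u≤b = Aδ.trans (Aδ.∧-greatest u≤a u≤b) (Aδ.reflexive (Aδ.Eq.sym (∧-homo _ _)))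
  e-meet ∂ u≤a u≤b = Aδ.trans (Aδ.reflexive (∨-homo _ _)) (Aδ.∨-least u≤a u≤b)

  pow-e-mono : (ε : OrderType n) → ∀ {a b} → Poset._≤_ (A.poset ^ ε) a b →
               Poset._≤_ (Aδ.poset ^ ε) (e ∘ a) (e ∘ b)
  pow-e-mono ε a≤b i = e-mono (ε i) (a≤b i)

  pow-e-reflects : (ε : OrderType n) → ∀ {a b} → Poset._≤_ (Aδ.poset ^ ε) (e ∘ a) (e ∘ b) →
                   Poset._≤_ (A.poset ^ ε) a b
  pow-e-reflects ε a≤b i = e-reflects (ε i) (a≤b i)

  module _ (D : DirectedSet ℓ) where
    open DirectedSet D

    compactness : ∀ s {φ : Index → A.Carrier} {x y} →
      (∀ {j k} → j ⊑ k → leq A.poset s (φ j) (φ k)) →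
      IsLimit Aδ.poset s (e ∘ φ) y → IsClosed A.poset Aδ.poset e s x → leq Aδ.poset s x y →
      ∃[ j ] leq Aδ.poset s x (e (φ j))
    compactness 𝟏 = U.compactness D
    compactness ∂ = U∂.compactness D

    limit-∧ : ∀ s {φ ψ : Index → A.Carrier} {x y} →
      (∀ {j k} → j ⊑ k → leq A.poset s (φ j) (φ k)) →
      (∀ {j k} → j ⊑ k → leq A.poset s (ψ j) (ψ k)) →
      IsLimit Aδ.poset s (e ∘ φ) x → IsLimit Aδ.poset s (e ∘ ψ) y →
      IsLimit Aδ.poset s (λ j → e (φ j A.∧ ψ j)) (x Aδ.∧ y)
    limit-∧ 𝟏 = U.limit-∧ D
    limit-∧ ∂ = U∂.limit-∨ D

    limit-∨ : ∀ s {φ ψ : Index → A.Carrier} {x y} →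
      (∀ {j k} → j ⊑ k → leq A.poset s (φ j) (φ k)) →
      (∀ {j k} → j ⊑ k → leq A.poset s (ψ j) (ψ k)) →
      IsLimit Aδ.poset s (e ∘ φ) x → IsLimit Aδ.poset s (e ∘ ψ) y →
      IsLimit Aδ.poset s (λ j → e (φ j A.∨ ψ j)) (x Aδ.∨ y)
    limit-∨ 𝟏 = U.limit-∨ D
    limit-∨ ∂ = U∂.limit-∧ D

    pow-approximates : (ε : OrderType n) → ∀ s {φ : Index → Vector A.Carrier n} {y} →
      (∀ i {j k} → j ⊑ k → leq A.poset (s Sign.* ε i) (φ j i) (φ k i)) →
      (∀ i → IsLimit Aδ.poset (s Sign.* ε i) (λ j → e (φ j i)) (y i)) →
      Approximates (A.poset ^ ε) (Aδ.poset ^ ε) (e ∘_) s φ y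
    pow-approximates {n} ε s {φ} {y} φ-mono lim =
      approx (pow-limit⁺ Aδ.poset ε s lim) catch
      where
      catch : ∀ {x} → IsClosed (A.poset ^ ε) (Aδ.poset ^ ε) (e ∘_) s x →
              leq (Aδ.poset ^ ε) s x y → ∃[ j ] leq (Aδ.poset ^ ε) s x (e ∘ φ j)
      catch {x} (K , κ , x-lim) x≤y =
        -- Each coordinate is caught at its own index; there are finitely many, so one later index
        -- serves them all.
        let k , c⊑k = bound-all (proj₁ ∘ caught)
        in k , pow-leq⁺ Aδ.poset ε s (λ i →
             leq-trans Aδ.poset (s Sign.* ε i) (proj₂ (caught i))
               (e-mono (s Sign.* ε i) (φ-mono i (c⊑k i))))
        where
        caught : ∀ i → ∃[ j ] leq Aδ.poset (s Sign.* ε i) (x i) (e (φ j i))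
        caught i = compactness (s Sign.* ε i) (φ-mono i) (lim i)
          (K , (λ k → κ k i) ,
           -- Closedness of sign s for the tuple is closedness of sign `s Sign.* ε i` in coordinate
           -- i, because `opposite` passes through the product.
           subst (λ r → IsLimit Aδ.poset r (λ k → e (κ k i)) (x i)) (opposite-* s (ε i))
             (pow-limit⁻ Aδ.poset ε (opposite s) x-lim i))
          (pow-leq⁻ Aδ.poset ε s x≤y i)

-- The extensions of an order-preserving map

module SigmaExtension (P P′ : Poset ℓ ℓ ℓ) (i : Poset.Carrier P → Poset.Carrier P′)
  (i-mono : ∀ {a b} → Poset._≤_ P a b → Poset._≤_ P′ (i a) (i b))
  (i-reflects : ∀ {a b} → Poset._≤_ P′ (i a) (i b) → Poset._≤_ P a b)
  {B : BDL ℓ} (Bδ : CanonicalExtension B) (h : Poset.Carrier P → BDL.Carrier B)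
  (h-mono : ∀ {a b} → Poset._≤_ P a b → BDL._≤_ B (h a) (h b)) where
  private
    module P = Poset P
    module P′ = Poset P′
  open CanonicalExtension Bδ
  open Unsigned Bδ using (e-mono)

  σ : P′.Carrier → Carrier
  σ = σ-ext P P′ i Bδ h

  σ-mono : ∀ {u w} → u P′.≤ w → σ u ≤ σ w
  σ-mono u≤w = proj₂ (⋁-supremum _) _ (λ { _ (image (cl , x≤u)) →
    proj₁ (⋁-supremum _) _ (image (cl , P′.trans x≤u u≤w)) })

  -- For `𝟏`, each closed x below y lies below some β j, so its contribution to the join is at most
  -- h (β j), and each β j is itself such an x. For `∂`, y is closed, so σ y is the meet of the h b
  -- over all b above y, and each such b is above some β j.
  σ-limit : ∀ s {J : Set ℓ} {β : J → P.Carrier} {y} →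
    Approximates P P′ i s β y → IsLimit poset s (e ∘ h ∘ β) (σ y)
  σ-limit 𝟏 {β = β} {y} (approx (β≤y , _) catch) =
    (λ j → trans
      (proj₂ (⋀-infimum _) _ (λ { _ (image βj≤a) → e-mono (h-mono (i-reflects βj≤a)) }))
      (proj₁ (⋁-supremum _) _ (image (embedded-closed (β j) , β≤y j)))) ,
    (λ w ≤w → proj₂ (⋁-supremum _) w (λ { _ (image (cl , x≤y)) →
      let j , x≤βj = catch (Closed⇒IsClosed P P′ i cl) x≤y
      in trans (proj₁ (⋀-infimum _) _ (image x≤βj)) (≤w j) }))
    where
    embedded-closed : ∀ a → Closed P P′ i (i a)
    embedded-closed a = (a P.≤_) ,
      (λ { _ (image a≤b) → i-mono a≤b }) , (λ w w≤ → w≤ (i a) (image P.refl))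
  σ-limit ∂ {β = β} {y} (approx (y≤β , greatest) catch) =
    (λ j → proj₂ (⋁-supremum _) _ (λ { _ (image (_ , x≤y)) →
      proj₁ (⋀-infimum _) _ (image (P′.trans x≤y (y≤β j))) })) ,
    (λ w w≤ → trans
      (proj₂ (⋀-infimum _) w (λ { _ (image {b} y≤b) →
        let j , βj≤b = catch (embedded-IsClosed P P′ i ∂ b) y≤b
        in trans (w≤ j) (e-mono (h-mono (i-reflects βj≤b))) }))
      (proj₁ (⋁-supremum _) _ (image (y-closed , P′.refl))))
    where
    y-closed : Closed P P′ i y
    -- The up-set generated by the family has the same infimum as the family.
    y-closed = (λ b → ∃[ j ] β j P.≤ b) ,
      (λ { _ (image (j , βj≤b)) → P′.trans (y≤β j) (i-mono βj≤b) }) ,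
      (λ w w≤ → greatest w (λ j → w≤ (i (β j)) (image (j , P.refl))))

module PiExtension (P P′ : Poset ℓ ℓ ℓ) (i : Poset.Carrier P → Poset.Carrier P′)
  (i-mono : ∀ {a b} → Poset._≤_ P a b → Poset._≤_ P′ (i a) (i b))
  (i-reflects : ∀ {a b} → Poset._≤_ P′ (i a) (i b) → Poset._≤_ P a b)
  {B : BDL ℓ} (Bδ : CanonicalExtension B) (h : Poset.Carrier P → BDL.Carrier B)
  (h-mono : ∀ {a b} → Poset._≤_ P a b → BDL._≤_ B (h a) (h b)) where
  open CanonicalExtension Bδ
  private
    -- Unfolding definitions, `π-ext` is `σ-ext` for the reversed posets and the dual canonical
    -- extension.
    module σ = SigmaExtension (Flip.poset P) (Flip.poset P′) i i-mono i-reflects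
                              (dualᶜ Bδ) h h-mono

  π : Poset.Carrier P′ → Carrier
  π = π-ext P P′ i Bδ h

  π-mono : ∀ {u w} → Poset._≤_ P′ u w → π u ≤ π w
  π-mono = σ.σ-mono

  π-limit : ∀ s {J : Set ℓ} {β : J → Poset.Carrier P} {y} →
    Approximates P P′ i s β y → IsLimit poset s (e ∘ h ∘ β) (π y)
  -- Reversal swaps the signs. The fields agree definitionally but the two record types differ,
  -- hence the repacking.
  π-limit 𝟏 (approx lim catch) = σ.σ-limit ∂ (approx lim catch)
  π-limit ∂ (approx lim catch) = σ.σ-limit 𝟏 (approx lim catch)

-- Terms

module _ {𝓢 : Signature o} where
  open Signature 𝓢

  -- `PositiveAs` is the case s = `𝟏`. The extra sign is that of the place where t stands, which
  -- lets inductions descend below argument places of order-type `∂`.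
  HasSign : {V : Set v} → Sign → (V → Sign) → Term 𝓢 V → Set (o ⊔ v)
  HasSign s ε t = ∀ x r → Occurs x r t → r ≡ s Sign.* ε x

  module _ {V : Set v} {ε : V → Sign} where

    var-sign : ∀ s {x} → HasSign s ε (var x) → ε x ≡ s
    var-sign s {x} hs with hs x 𝟏 here
    var-sign 𝟏 hs | eq = sym eq
    var-sign ∂ {x} hs | eq = *-transpose ∂ (ε x) (sym eq)

    f-sign : ∀ s {f ts} → HasSign s ε (opᶠ f ts) →
             ∀ i → HasSign (s Sign.* εᶠ f i) ε (ts i)
    f-sign s {f} hs i x r occ = *-transpose² (εᶠ f i) r s (ε x) (hs x _ (in-f i occ))

    g-sign : ∀ s {g ts} → HasSign s ε (opᵍ g ts) →
             ∀ i → HasSign (s Sign.* εᵍ g i) ε (ts i)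
    g-sign s {g} hs i x r occ = *-transpose² (εᵍ g i) r s (ε x) (hs x _ (in-g i occ))

-- Expansions with monotone connectives

record IsMonotone {𝓢 : Signature o} (A : Expansion 𝓢 ℓ) : Set (o ⊔ ℓ) where
  open Signature 𝓢
  open Expansion A
  field
    f-mono : ∀ f {xs ys} → Poset._≤_ (poset ^ εᶠ f) xs ys → ⟦ f ⟧ᶠ xs ≤ ⟦ f ⟧ᶠ ys
    g-mono : ∀ g {xs ys} → Poset._≤_ (poset ^ εᵍ g) xs ys → ⟦ g ⟧ᵍ xs ≤ ⟦ g ⟧ᵍ ys

-- This serves both A, where monotonicity comes from normality, and its canonical extension, where
-- it comes from the formulas for σ and π.
module MonotoneExpansion {𝓢 : Signature o} (A : Expansion 𝓢 ℓ) (isMonotone : IsMonotone A) where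
  open Signature 𝓢
  open Expansion A
  open IsMonotone isMonotone
  private
    module ∧ = MeetProperties meetSemilattice
    module ∨ = JoinProperties joinSemilattice

  op-leq : (ε : OrderType n) {h : Vector Carrier n → Carrier} →
           (∀ {xs ys} → Poset._≤_ (poset ^ ε) xs ys → h xs ≤ h ys) →
           ∀ s {xs ys} → leq (poset ^ ε) s xs ys → leq poset s (h xs) (h ys)
  op-leq ε h-mono 𝟏 = h-mono
  op-leq ε h-mono ∂ = h-mono

  ∧-leq : ∀ s {x x′ y y′} → leq poset s x x′ → leq poset s y y′ → leq poset s (x ∧ y) (x′ ∧ y′)
  ∧-leq 𝟏 = ∧.∧-monotonic
  ∧-leq ∂ = ∧.∧-monotonic

  ∨-leq : ∀ s {x x′ y y′} → leq poset s x x′ → leq poset s y y′ → leq poset s (x ∨ y) (x′ ∨ y′)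
  ∨-leq 𝟏 = ∨.∨-monotonic
  ∨-leq ∂ = ∨.∨-monotonic

  module _ {V : Set v} {ε : V → Sign} {ρ ρ′ : V → Carrier}
           (ρ≤ρ′ : ∀ x → leq poset (ε x) (ρ x) (ρ′ x)) where

    term-mono : ∀ s t → HasSign s ε t → leq poset s (⟦ t ⟧ ρ) (⟦ t ⟧ ρ′)
    term-mono s (var x)    hs = subst (λ r → leq poset r (ρ x) (ρ′ x)) (var-sign s hs) (ρ≤ρ′ x)
    term-mono s ⊥ᵗ         hs = leq-refl poset s
    term-mono s ⊤ᵗ         hs = leq-refl poset s
    term-mono s (t ∧ᵗ u)   hs = ∧-leq s (term-mono s t (λ x r → hs x r ∘ in-∧ˡ))
                                        (term-mono s u (λ x r → hs x r ∘ in-∧ʳ))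
    term-mono s (t ∨ᵗ u)   hs = ∨-leq s (term-mono s t (λ x r → hs x r ∘ in-∨ˡ))
                                        (term-mono s u (λ x r → hs x r ∘ in-∨ʳ))
    term-mono s (opᶠ f ts) hs = op-leq (εᶠ f) (f-mono f) s
      (pow-leq⁺ poset (εᶠ f) s (λ i → term-mono (s Sign.* εᶠ f i) (ts i) (f-sign s hs i)))
    term-mono s (opᵍ g ts) hs = op-leq (εᵍ g) (g-mono g) s
      (pow-leq⁺ poset (εᵍ g) s (λ i → term-mono (s Sign.* εᵍ g i) (ts i) (g-sign s hs i)))

  op-cong : (ε : OrderType n) {h : Vector Carrier n → Carrier} →
            (∀ {xs ys} → Poset._≤_ (poset ^ ε) xs ys → h xs ≤ h ys) →
            ∀ {xs ys} → (∀ i → xs i ≈ ys i) → h xs ≈ h ys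
  op-cong ε h-mono xs≈ys = antisym (h-mono (Poset.reflexive (poset ^ ε) xs≈ys))
    (h-mono (Poset.reflexive (poset ^ ε) (λ i → Eq.sym (xs≈ys i))))

  module _ {V : Set v} {W : Set w} {θ : V → Term 𝓢 W} {ρ : W → Carrier} {ρ′ : V → Carrier}
           (θ≈ : ∀ x → ⟦ θ x ⟧ ρ ≈ ρ′ x) where

    -- Stated up to `≈` because argument tuples are functions, compared pointwise; monotonicity and
    -- antisymmetry make the connectives respect this.
    substitution : ∀ t → ⟦ t [ θ ] ⟧ ρ ≈ ⟦ t ⟧ ρ′
    substitution (var x)    = θ≈ x
    substitution ⊥ᵗ         = Eq.refl
    substitution ⊤ᵗ         = Eq.refl
    substitution (t ∧ᵗ u)   = ∧.∧-cong (substitution t) (substitution u)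
    substitution (t ∨ᵗ u)   = ∨.∨-cong (substitution t) (substitution u)
    substitution (opᶠ f ts) = op-cong (εᶠ f) (f-mono f) (λ i → substitution (ts i))
    substitution (opᵍ g ts) = op-cong (εᵍ g) (g-mono g) (λ i → substitution (ts i))

  joinᵗ-join : ∀ s {W : Set w} (t u : Term 𝓢 W) {ρ} →
               ⟦ joinᵗ s t u ⟧ ρ ≈ join s (⟦ t ⟧ ρ) (⟦ u ⟧ ρ)
  joinᵗ-join 𝟏 t u = Eq.refl
  joinᵗ-join ∂ t u = Eq.refl

  module _ (ε : OrderType n) (π : Term 𝓢 (Fin n)) (ρ : Fin n ⊎ Fin n → Carrier) where
    private
      a b : Vector Carrier n
      a = ρ ∘ inj₁
      b = ρ ∘ inj₂

      ⟦∨⟧ : ⟦ π [ p̄ ∨[ ε ] q̄ ] ⟧ ρ ≈ ⟦ π ⟧ (λ i → join (ε i) (a i) (b i))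
      ⟦∨⟧ = substitution (λ i → joinᵗ-join (ε i) (p̄ i) (q̄ i)) π

      ∨⟦⟧ : ⟦ (π [ p̄ ]) ∨ᵗ (π [ q̄ ]) ⟧ ρ ≈ ⟦ π ⟧ a ∨ ⟦ π ⟧ b
      ∨⟦⟧ = ∨.∨-cong (substitution (λ _ → Eq.refl) π) (substitution (λ _ → Eq.refl) π)

    valid⇒additive : ⟦ π [ p̄ ∨[ ε ] q̄ ] ⟧ ρ ≤ ⟦ (π [ p̄ ]) ∨ᵗ (π [ q̄ ]) ⟧ ρ →
                     ⟦ π ⟧ (λ i → join (ε i) (a i) (b i)) ≤ ⟦ π ⟧ a ∨ ⟦ π ⟧ b
    valid⇒additive valid =
      trans (reflexive (Eq.sym ⟦∨⟧)) (trans valid (reflexive ∨⟦⟧))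

    additive⇒valid : ⟦ π ⟧ (λ i → join (ε i) (a i) (b i)) ≤ ⟦ π ⟧ a ∨ ⟦ π ⟧ b →
                     ⟦ π [ p̄ ∨[ ε ] q̄ ] ⟧ ρ ≤ ⟦ (π [ p̄ ]) ∨ᵗ (π [ q̄ ]) ⟧ ρ
    additive⇒valid additive =
      trans (reflexive ⟦∨⟧) (trans additive (reflexive (Eq.sym ∨⟦⟧)))

-- Monotonicity of the connectives of a DLE

module _ (A : BDL ℓ) where
  open BDL A hiding (refl)

  x≤join : ∀ s x y → leq poset s x (join s x y)
  x≤join 𝟏 = x≤x∨y
  x≤join ∂ = x∧y≤x

  y≤join : ∀ s x y → leq poset s y (join s x y)
  y≤join 𝟏 = y≤x∨y
  y≤join ∂ = x∧y≤y

  join-least : ∀ s {x y z} → leq poset s x z → leq poset s y z → leq poset s (join s x y) z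
  join-least 𝟏 = ∨-least
  join-least ∂ = ∧-greatest

  meet≤x : ∀ s x y → leq poset s (meet s x y) x
  meet≤x 𝟏 = x∧y≤x
  meet≤x ∂ = x≤x∨y

  meet≤y : ∀ s x y → leq poset s (meet s x y) y
  meet≤y 𝟏 = x∧y≤y
  meet≤y ∂ = y≤x∨y

  meet-greatest : ∀ s {x y z} → leq poset s z x → leq poset s z y → leq poset s z (meet s x y)
  meet-greatest 𝟏 = ∧-greatest
  meet-greatest ∂ = ∨-least

  leq-antisym : ∀ s {x y} → leq poset s x y → leq poset s y x → x ≈ y
  leq-antisym s = IsPartialOrder.antisym (leq-isPartialOrder poset s)

  -- The coordinates are changed one at a time, the first before the others. The uses of `h-cong`
  -- pass between tuples that agree only pointwise.
  coordinatewise-mono : (ε : OrderType n) (h : Vector Carrier n → Carrier) →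
    (∀ {xs ys} → (∀ i → xs i ≈ ys i) → h xs ≈ h ys) →
    (∀ i xs {a b} → leq poset (ε i) a b →
      h (updateAt xs i (const a)) ≤ h (updateAt xs i (const b))) →
    ∀ {xs ys} → Poset._≤_ (poset ^ ε) xs ys → h xs ≤ h ys
  coordinatewise-mono {zero}  ε h h-cong h-coord xs≤ys = reflexive (h-cong λ ())
  coordinatewise-mono {suc n} ε h h-cong h-coord {xs} {ys} xs≤ys =
    trans (reflexive (h-cong λ { zero → Eq.refl ; (suc i) → Eq.refl }))
      (trans (h-coord zero xs {head xs} {head ys} (xs≤ys zero))
        (trans (reflexive (h-cong λ { zero → Eq.refl ; (suc i) → Eq.refl }))
          (trans (coordinatewise-mono (ε ∘ suc) (h ∘ (head ys ◂_))
                   (λ eq → h-cong λ { zero → Eq.refl ; (suc i) → eq i })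
                   (λ i xs a≤b → trans (reflexive (h-cong λ { zero → Eq.refl ; (suc _) → Eq.refl }))
                     (trans (h-coord (suc i) (head ys ◂ xs) a≤b)
                            (reflexive (h-cong λ { zero → Eq.refl ; (suc _) → Eq.refl }))))
                   {tail xs} {tail ys} (xs≤ys ∘ suc))
            (reflexive (h-cong λ { zero → Eq.refl ; (suc i) → Eq.refl })))))

  module _ (ε : OrderType n) (h : Vector Carrier n → Carrier)
           (h-cong : ∀ {xs ys} → (∀ i → xs i ≈ ys i) → h xs ≈ h ys) where

    private
      update-cong : ∀ i xs {a b} → a ≈ b →
                    h (updateAt xs i (const a)) ≈ h (updateAt xs i (const b))
      update-cong i xs a≈b = h-cong (go i xs a≈b)
        where
        go : ∀ {m} (i : Fin m) xs {a b} → a ≈ b → ∀ j →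
             updateAt xs i (const a) j ≈ updateAt xs i (const b) j
        go zero    xs a≈b zero    = a≈b
        go zero    xs a≈b (suc j) = Eq.refl
        go (suc i) xs a≈b zero    = Eq.refl
        go (suc i) xs a≈b (suc j) = go i (tail xs) a≈b j

    -- If a is below b in the order of coordinate i, their join there is b, so preservation exhibits
    -- the value at b as a join with the value at a.
    join-preserving⇒mono :
      (∀ i xs a b → h (updateAt xs i (const (join (ε i) a b))) ≈
                    h (updateAt xs i (const a)) ∨ h (updateAt xs i (const b))) →
      ∀ {xs ys} → Poset._≤_ (poset ^ ε) xs ys → h xs ≤ h ys
    join-preserving⇒mono h-join = coordinatewise-mono ε h h-cong λ i xs {a} {b} a≤b →
      trans (x≤x∨y _ _) (reflexive (Eq.trans (Eq.sym (h-join i xs a b))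
        (update-cong i xs (leq-antisym (ε i)
          (join-least (ε i) a≤b (leq-refl poset (ε i))) (y≤join (ε i) a b)))))

    meet-preserving⇒mono :
      (∀ i xs a b → h (updateAt xs i (const (meet (ε i) a b))) ≈
                    h (updateAt xs i (const a)) ∧ h (updateAt xs i (const b))) →
      ∀ {xs ys} → Poset._≤_ (poset ^ ε) xs ys → h xs ≤ h ys
    meet-preserving⇒mono h-meet = coordinatewise-mono ε h h-cong λ i xs {a} {b} a≤b →
      trans (reflexive (Eq.trans
        (update-cong i xs (leq-antisym (ε i)
          (meet-greatest (ε i) (leq-refl poset (ε i)) a≤b) (meet≤x (ε i) a b)))
        (h-meet i xs a b)))
        (x∧y≤y _ _)

-- Term functions on the canonical extension

module Additivity {𝓢 : Signature o} (A : DLE 𝓢 ℓ) (Aδ : CanonicalExtension (DLE.bdl A)) where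
  open Signature 𝓢
  private
    module A = DLE A
    module Aδ = Expansion (canonicalExtension A Aδ)
    e = CanonicalExtension.e Aδ
  open Canonical Aδ

  A-mono : IsMonotone A.expansion
  A-mono = record
    { f-mono = λ f → join-preserving⇒mono A.bdl (εᶠ f) A.⟦ f ⟧ᶠ (A.f-cong f) (A.f-join f)
    ; g-mono = λ g → meet-preserving⇒mono A.bdl (εᵍ g) A.⟦ g ⟧ᵍ (A.g-cong g) (A.g-meet g)
    }
  open IsMonotone A-mono

  module F (f : F) = SigmaExtension (A.poset ^ εᶠ f) (Aδ.poset ^ εᶠ f) (e ∘_)
    (pow-e-mono (εᶠ f)) (pow-e-reflects (εᶠ f)) Aδ A.⟦ f ⟧ᶠ (f-mono f)
  module G (g : G) = PiExtension (A.poset ^ εᵍ g) (Aδ.poset ^ εᵍ g) (e ∘_)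
    (pow-e-mono (εᵍ g)) (pow-e-reflects (εᵍ g)) Aδ A.⟦ g ⟧ᵍ (g-mono g)

  Aδ-mono : IsMonotone (canonicalExtension A Aδ)
  Aδ-mono = record { f-mono = F.σ-mono ; g-mono = G.π-mono }

  module MA = MonotoneExpansion A.expansion A-mono
  module MAδ = MonotoneExpansion (canonicalExtension A Aδ) Aδ-mono

  -- Esakia-type lemma: it gives the intersection formula on closed tuples and,
  -- for the opposite order-type and sign, the union formula on open tuples.
  module _ (D : DirectedSet ℓ) {V : Set v} {ε : V → Sign}
           (α : DirectedSet.Index D → V → A.Carrier)
           (α-mono : ∀ {j k} → DirectedSet._⊑_ D j k → ∀ x → leq A.poset (ε x) (α j x) (α k x))
           (y : V → Aδ.Carrier)
           (y-limit : ∀ x → IsLimit Aδ.poset (ε x) (λ j → e (α j x)) (y x)) where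
    open DirectedSet D

    private
      mono : ∀ s t → HasSign s ε t → ∀ {j k} → j ⊑ k →
             leq A.poset s (A.⟦ t ⟧ (α j)) (A.⟦ t ⟧ (α k))
      mono s t hs j⊑k = MA.term-mono (α-mono j⊑k) s t hs

    term-limit : ∀ s t → HasSign s ε t →
                 IsLimit Aδ.poset s (λ j → e (A.⟦ t ⟧ (α j))) (Aδ.⟦ t ⟧ y)
    term-limit s (var x) hs = subst (λ r → IsLimit Aδ.poset r (λ j → e (α j x)) (y x))
                                    (var-sign s hs) (y-limit x)
    -- For one of the two signs a constant family has the required limit only over a nonempty index
    -- type, whence `point`; likewise for `⊤ᵗ`.
    term-limit s ⊥ᵗ hs = limit-⊥ s point
    term-limit s ⊤ᵗ hs = limit-⊤ s point
    term-limit s (t ∧ᵗ u) hs =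
      limit-∧ D s (mono s t ht) (mono s u hu) (term-limit s t ht) (term-limit s u hu)
      where
      ht = λ x r → hs x r ∘ in-∧ˡ
      hu = λ x r → hs x r ∘ in-∧ʳ
    term-limit s (t ∨ᵗ u) hs =
      limit-∨ D s (mono s t ht) (mono s u hu) (term-limit s t ht) (term-limit s u hu)
      where
      ht = λ x r → hs x r ∘ in-∨ˡ
      hu = λ x r → hs x r ∘ in-∨ʳ
    term-limit s (opᶠ f ts) hs = F.σ-limit f s (pow-approximates D (εᶠ f) s
      (λ i → mono (s Sign.* εᶠ f i) (ts i) (f-sign s hs i))
      (λ i → term-limit (s Sign.* εᶠ f i) (ts i) (f-sign s hs i)))
    term-limit s (opᵍ g ts) hs = G.π-limit g s (pow-approximates D (εᵍ g) s
      (λ i → mono (s Sign.* εᵍ g i) (ts i) (g-sign s hs i))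
      (λ i → term-limit (s Sign.* εᵍ g i) (ts i) (g-sign s hs i)))

  -- Transfer of additivity

  module _ (ε : OrderType n) (π : Term 𝓢 (Fin n)) (positive : PositiveAs ε π)
    (additive : ∀ (a b : Vector A.Carrier n) →
      A.⟦ π ⟧ (λ i → A.join (ε i) (a i) (b i)) A.≤ A.⟦ π ⟧ a A.∨ A.⟦ π ⟧ b) where

    private
      -- Reversing both the order-type and the sign of the term changes nothing. In this form
      -- `term-limit` computes π on closed tuples as a filtered meet.
      negative : HasSign ∂ (opposite ∘ ε) π
      negative i r occ with refl ← positive i r occ = sym (opposite-involutive r)

      -- A tuple from A is the limit of a constant family over one point, so `term-limit` applies.
      embed-≤ : ∀ a → e (A.⟦ π ⟧ a) Aδ.≤ Aδ.⟦ π ⟧ (e ∘ a)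
      embed-≤ a = proj₁ (term-limit D {ε = ε} (λ _ → a) (λ _ i → leq-refl A.poset (ε i)) (e ∘ a)
        (λ i → (λ _ → leq-refl Aδ.poset (ε i)) , (λ w e≤w → e≤w tt)) 𝟏 π positive) tt
        where
        D : DirectedSet ℓ
        D = record { Index = Unit ; _⊑_ = λ _ _ → Unit ; ⊑-trans = λ _ _ → tt
                   ; point = tt ; bound = λ _ _ → tt , tt , tt }

      π-mono : ∀ {x y} → Poset._≤_ (Aδ.poset ^ ε) x y → Aδ.⟦ π ⟧ x Aδ.≤ Aδ.⟦ π ⟧ y
      π-mono x≤y = MAδ.term-mono x≤y 𝟏 π positive

    module _ {m : Aδ.Carrier} (m-open : IsClosed A.poset Aδ.poset e ∂ m) where

      Ideal : Set ℓ
      Ideal = ∃[ a ] e (A.⟦ π ⟧ a) Aδ.≤ m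

      -- The value at m of a right adjoint of π: once some u has π(u) ≤ m, the lemmas below make `■`
      -- the greatest such tuple.
      ■ : Vector Aδ.Carrier n
      ■ i = proj₁ (supremum (ε i) {Ideal} (λ a → proj₁ a i))

      ■-limit : ∀ i → IsLimit Aδ.poset (ε i) {Ideal} (λ a → e (proj₁ a i)) (■ i)
      ■-limit i = proj₂ (supremum (ε i) (λ a → proj₁ a i))

      module _ {u : Vector Aδ.Carrier n} (πu≤m : Aδ.⟦ π ⟧ u Aδ.≤ m) where

        -- π need not preserve bottom; it is the given u that makes the ideal nonempty, as π(bottom)
        -- ≤ π(u) ≤ m.
        bottom∈Ideal : Ideal
        bottom∈Ideal = (A.bottom ∘ ε) , Aδ.trans (embed-≤ _)
          (Aδ.trans (π-mono (λ i → e-bottom (ε i))) πu≤m)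

        π■≤m : Aδ.⟦ π ⟧ ■ Aδ.≤ m
        π■≤m = proj₂ (term-limit D proj₁ (λ a≤b → a≤b) ■ ■-limit 𝟏 π positive) m proj₂
          where
          D : DirectedSet ℓ
          D = record
            { Index   = Ideal
            ; _⊑_     = λ a b → Poset._≤_ (A.poset ^ ε) (proj₁ a) (proj₁ b)
            ; ⊑-trans = Poset.trans (A.poset ^ ε)
            ; point   = bottom∈Ideal
            -- Additivity on A enters here: it keeps the join of a and b in the ideal.
            ; bound   = λ { (a , πa≤m) (b , πb≤m) →
                ((λ i → A.join (ε i) (a i) (b i)) ,
                 Aδ.trans (e-mono 𝟏 (additive a b))
                   (Aδ.trans (Aδ.reflexive (e-∨ _ _)) (Aδ.∨-least πa≤m πb≤m))) ,
                (λ i → x≤join A.bdl (ε i) (a i) (b i)) ,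
                (λ i → y≤join A.bdl (ε i) (a i) (b i)) }
            }
            where
            open LatticeMorphisms.IsLatticeMonomorphism
              (CanonicalExtension.e-isLatticeMonomorphism Aδ) renaming (∨-homo to e-∨)

        -- One coordinate at a time, reading the order by `ε i`: a closed x below u i is completed
        -- by bottoms to a closed tuple `x̄` ≤ u, so π(`x̄`) ≤ m. Compactness replaces x by some b
        -- from A above it, and then `α` b lies in the ideal.
        u≤■ : Poset._≤_ (Aδ.poset ^ ε) u ■
        u≤■ i = leq-via-closed (ε i) below
          where
          below : ∀ {x} → IsClosed A.poset Aδ.poset e (ε i) x →
                  leq Aδ.poset (ε i) x (u i) → leq Aδ.poset (ε i) x (■ i)
          below {x} (K , κ , κ≥x , greatest) x≤u =
            -- The dual form of compactness: the filtered meet π(`x̄`) of the π(`α` b) is below the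
            -- open m, so one of them already is.
            let (b , x≤b) , πb≤m = compactness D ∂
                  (λ {b} {c} c≤b → MA.term-mono (α-mono {b} {c} c≤b) ∂ π negative)
                  (term-limit D α (λ {b} {c} → α-mono {b} {c}) x̄ α-limit ∂ π negative)
                  m-open (Aδ.trans (π-mono x̄≤u) πu≤m)
            in leq-trans Aδ.poset (ε i) x≤b (at-i (proj₁ (■-limit i) (α (b , x≤b) , πb≤m)))
            where
            Above : Set ℓ
            Above = ∃[ b ] leq Aδ.poset (ε i) x (e b)

            D : DirectedSet ℓ
            D = record
              { Index   = Above
              -- Later indices are lower approximations of x, so that meets provide the bounds.
              ; _⊑_     = λ b c → leq A.poset (ε i) (proj₁ c) (proj₁ b)
              ; ⊑-trans = λ b≥c c≥d → leq-trans A.poset (ε i) c≥d b≥c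
              ; point   = A.top (ε i) , e-top (ε i)
              ; bound   = λ { (b , x≤b) (c , x≤c) →
                  (A.meet (ε i) b c , e-meet (ε i) x≤b x≤c) ,
                  meet≤x A.bdl (ε i) b c , meet≤y A.bdl (ε i) b c }
              }

            α : Above → Vector A.Carrier n
            α (b , _) = (A.bottom ∘ ε) [ i ]≔ b

            x̄ : Vector Aδ.Carrier n
            x̄ = (e ∘ A.bottom ∘ ε) [ i ]≔ x

            α-mono : ∀ {b c} → leq A.poset (ε i) (proj₁ c) (proj₁ b) →
                     ∀ j → leq A.poset (opposite (ε j)) (α b j) (α c j)
            α-mono c≤b j with j ≟ i
            ... | yes refl = leq-opposite⁺ A.poset (ε i) c≤b
            ... | no _     = leq-refl A.poset (opposite (ε j))

            α-limit : ∀ j → IsLimit Aδ.poset (opposite (ε j)) (λ b → e (α b j)) (x̄ j)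
            α-limit j with j ≟ i
            ... | yes refl = (λ b → leq-opposite⁺ Aδ.poset (ε i) (proj₂ b)) ,
              -- Each `κ` k is itself in `Above`, so a bound of that family is also a bound of the
              -- family whose limit is x.
              (λ w ≤w → greatest w (λ k → ≤w (κ k , leq-opposite⁻ Aδ.poset (ε i) (κ≥x k))))
            ... | no _     = (λ _ → leq-refl Aδ.poset (opposite (ε j))) ,
              (λ w ≤w → ≤w (A.top (ε i) , e-top (ε i)))

            x̄≤u : Poset._≤_ (Aδ.poset ^ ε) x̄ u
            x̄≤u j with j ≟ i
            ... | yes refl = x≤u
            ... | no _     = e-bottom (ε j)

            at-i : ∀ {b y} → leq Aδ.poset (ε i) (e (((A.bottom ∘ ε) [ i ]≔ b) i)) y →
                   leq Aδ.poset (ε i) (e b) y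
            at-i le with i ≟ i
            ... | yes _  = le
            ... | no i≢i = contradiction refl i≢i

    additive-δ : ∀ (u v : Vector Aδ.Carrier n) →
      Aδ.⟦ π ⟧ (λ i → Aδ.join (ε i) (u i) (v i)) Aδ.≤ Aδ.⟦ π ⟧ u Aδ.∨ Aδ.⟦ π ⟧ v
    additive-δ u v = leq-via-closed ∂ λ m-open πu∨πv≤m →
      let πu≤m = Aδ.trans (Aδ.x≤x∨y _ _) πu∨πv≤m
          πv≤m = Aδ.trans (Aδ.y≤x∨y _ _) πu∨πv≤m
      in Aδ.trans
           -- `■` depends on m alone, so u and v lie below the same tuple, and hence so does their
           -- join.
           (π-mono (λ i → join-least Aδ.bdl (ε i) (u≤■ m-open πu≤m i) (u≤■ m-open πv≤m i)))
           (π■≤m m-open πu≤m)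

theorem32 : ∀ {o ℓ} {𝓢 : Signature o} (A : DLE 𝓢 ℓ) (Aδ : CanonicalExtension (DLE.bdl A))
    (n : ℕ) (ε : OrderType n) (π : Term 𝓢 (Fin n)) → PositiveAs ε π →
    DLE.expansion A ⊨ π [ p̄ ∨[ ε ] q̄ ] ≤ ((π [ p̄ ]) ∨ᵗ (π [ q̄ ])) →
    canonicalExtension A Aδ ⊨ π [ p̄ ∨[ ε ] q̄ ] ≤ ((π [ p̄ ]) ∨ᵗ (π [ q̄ ]))
theorem32 A Aδ n ε π positive valid ρ =
  MAδ.additive⇒valid ε π ρ (additive-δ ε π positive
    (λ a b → MA.valid⇒additive ε π _ (valid ([ a , b ]))) (ρ ∘ inj₁) (ρ ∘ inj₂))
  where open Additivity A Aδ
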